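{- Let $r\ge 2$ be an integer and let $f$ be the sequence defined by $f(0)=0$, $f(1)=1$ and $f(n)=r f(n-1)+f(n-2)$ for $n\ge 2$. Let $N>0$ be an integer. There is no integer $C$ such that for every integer $n\ge 0$ there exists an integer index $j\ge 0$ (depending on $n$ and $N$) with $$\sum_{i=0}^{4N+1} f(n+i) = C\cdot f(j).$$ -}

module Defs where

open import Data.Nat using (ℕ; zero; suc; _+_; _*_)

f : ℕ → ℕ → ℕ
f r zero          = 0
f r (suc zero)    = 1
f r (suc (suc n)) = r * f r (suc n) + f r n

{-# OPTIONS --safe #-}
-- Write T a = f a + f (a + 1).  The window sum factors as E * T (n + 2 N), with
-- E independent of n.  If E * T a = C * f j and E * T (a + 1) = C * f j', comparing
-- sizes forces j' = j + 1, so T (a + 1) * f j = T a * f (j + 1).  Consecutive values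
-- of T, and of f, are coprime; hence T a = f j, which is impossible because T a lies
-- strictly between f (a + 1) and f (a + 2) when r ≥ 2 and a ≥ 1.
module Submission where

open import Defs
open import Data.Nat using (ℕ; zero; suc; _+_; _*_; _≤_; _<_; z≤n; s≤s⁻¹; z<s; NonZero; >-nonZero)
open import Data.Nat.Coprimality using (Coprime; coprime-divisor)
open import Data.Nat.Divisibility using (_∣_; divides; ∣m+n∣m⇒∣n; ∣n⇒∣m*n; ∣-antisym; ∣1⇒≡1)
open import Data.Nat.ListAction using (sum)
open import Data.Nat.ListAction.Properties using (sum-++)
open import Data.Nat.Properties
open import Data.Nat.Tactic.RingSolver using (solve-∀)
open import Data.Integer as ℤ using (ℤ; +_)
open import Data.Integer.Properties using (abs-*)
open import Data.List using (map; upTo; applyUpTo; [_]; _++_)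
open import Data.List.Properties using (map-upTo; applyUpTo-∷ʳ)
open import Data.Empty using (⊥)
open import Data.Product using (Σ-syntax; ∃-syntax; _,_)
open import Data.Sum using (inj₁; inj₂)
open import Function using (_∘_)
open import Relation.Nullary using (¬_)
open import Relation.Binary.PropositionalEquality using (_≡_; refl; sym; trans; cong; cong₂; subst; module ≡-Reasoning)

-- Linear recurrences of order two with arbitrary initial values.

record Recurrent (r : ℕ) (g : ℕ → ℕ) : Set where
  constructor recurrent
  field step : ∀ n → g (2 + n) ≡ r * g (1 + n) + g n

open Recurrent

f-recurrent : ∀ r → Recurrent r (f r)
f-recurrent r = recurrent λ _ → refl

-- `Recurrent` leaves the initial values free precisely so that shifts qualify: the windows start at
-- any `n`, and their induction moves the start by two.
shift-recurrent : ∀ {r g} k → Recurrent r g → Recurrent r (g ∘ (_+_ k))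
step (shift-recurrent k rec) n
  rewrite +-suc k (suc n) | +-suc k n = step rec (k + n)

pairSum : (ℕ → ℕ) → ℕ → ℕ
pairSum g n = g n + g (suc n)

pairSum-recurrent : ∀ {r g} → Recurrent r g → Recurrent r (pairSum g)
step (pairSum-recurrent {r} {g} rec) n = begin
  g (2 + n) + g (3 + n)
    ≡⟨ cong₂ _+_ (step rec n) (step rec (suc n)) ⟩
  (r * g (1 + n) + g n) + (r * g (2 + n) + g (1 + n))
    ≡⟨ regroup r (g n) (g (1 + n)) (g (2 + n)) ⟩
  r * (g (1 + n) + g (2 + n)) + (g n + g (1 + n)) ∎
  where
  open ≡-Reasoning
  regroup : ∀ r x y z → (r * y + x) + (r * z + y) ≡ r * (y + z) + (x + y)
  regroup = solve-∀

consecutive-coprime : ∀ {r g} → Recurrent r g → Coprime (g 0) (g 1) →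
  ∀ n → Coprime (g n) (g (suc n))
consecutive-coprime rec c zero = c
consecutive-coprime {r} {g} rec c (suc n) {d} (d∣y , d∣z) =
  consecutive-coprime rec c n
    (∣m+n∣m⇒∣n (subst (d ∣_) (step rec n) d∣z) (∣n⇒∣m*n r d∣y) , d∣y)

-- Induction on `k` with `n` free: one unit moves from `k` to `n`, and the recurrence at `n` then
-- regroups into the recurrence of `f r`.
addition : ∀ {r g} → Recurrent r g → ∀ k n →
  g (suc k + n) ≡ f r (suc k) * g (suc n) + f r k * g n
addition {r} {g} rec zero n = sym (trans (+-identityʳ _) (*-identityˡ _))
addition {r} {g} rec (suc k) n = begin
  g (2 + k + n)
    ≡⟨ cong g (+-suc (suc k) n) ⟨
  g (suc k + suc n)
    ≡⟨ addition rec k (suc n) ⟩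
  f r (suc k) * g (2 + n) + f r k * g (suc n)
    ≡⟨ cong (λ z → f r (suc k) * z + f r k * g (suc n)) (step rec n) ⟩
  f r (suc k) * (r * g (suc n) + g n) + f r k * g (suc n)
    ≡⟨ regroup r (f r (suc k)) (f r k) (g (suc n)) (g n) ⟩
  (r * f r (suc k) + f r k) * g (suc n) + f r (suc k) * g n ∎
  where
  open ≡-Reasoning
  regroup : ∀ r a b y x → a * (r * y + x) + b * y ≡ (r * a + b) * y + a * x
  regroup = solve-∀

-- d'Ocagne's identity at an even index, moved so that no subtraction occurs.
dOcagne-even : ∀ {r g} → Recurrent r g → ∀ q →
  g 0 + f r (q * 2) * g (suc (q * 2)) ≡ f r (suc (q * 2)) * g (q * 2)
dOcagne-even rec zero = refl
dOcagne-even {r} {g} rec (suc q)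
  rewrite step rec (suc (q * 2)) | step rec (q * 2) =
  trans (regroup r (f r (q * 2)) (f r (suc (q * 2))) (g 0) (g (q * 2)) (g (suc (q * 2))))
    (trans (cong (_+ rest) (dOcagne-even rec q))
      (collect r (f r (q * 2)) (f r (suc (q * 2))) (g (q * 2)) (g (suc (q * 2)))))
  where
  rest : ℕ
  rest = (r * f r (suc (q * 2)) + f r (q * 2)) * (r * (r * g (suc (q * 2)) + g (q * 2)))
       + r * f r (suc (q * 2)) * g (suc (q * 2))
  regroup : ∀ r a b z x y →
    z + (r * b + a) * (r * (r * y + x) + y)
    ≡ (z + a * y) + ((r * b + a) * (r * (r * y + x)) + r * b * y)
  regroup = solve-∀
  collect : ∀ r a b x y →
    b * x + ((r * b + a) * (r * (r * y + x)) + r * b * y)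
    ≡ (r * (r * b + a) + b) * (r * y + x)
  collect = solve-∀

-- The companion Lucas number of index `k + 1`; the shift by one keeps all indices natural.
lucas : ℕ → ℕ → ℕ
lucas r k = f r (2 + k) + f r k

-- Expand `g (p + p)` about `p` by the addition formula; d'Ocagne's identity then absorbs `g 0`. It
-- does so with a plus sign because `p` is even.
symmetric-sum : ∀ {r g} → Recurrent r g → ∀ q → let p = suc q * 2 in
  g 0 + g (p + p) ≡ lucas r (suc (q * 2)) * g p
symmetric-sum {r} {g} rec q = begin
  g 0 + g (p + p)
    ≡⟨ cong (_+_ (g 0)) (addition rec (suc (q * 2)) p) ⟩
  g 0 + (f r p * g (suc p) + f r (suc (q * 2)) * g p)
    ≡⟨ +-assoc (g 0) _ _ ⟨
  (g 0 + f r p * g (suc p)) + f r (suc (q * 2)) * g p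
    ≡⟨ cong (_+ f r (suc (q * 2)) * g p) (dOcagne-even rec (suc q)) ⟩
  f r (suc p) * g p + f r (suc (q * 2)) * g p
    ≡⟨ *-distribʳ-+ (g p) (f r (suc p)) (f r (suc (q * 2))) ⟨
  lucas r (suc (q * 2)) * g p ∎
  where
  open ≡-Reasoning
  p : ℕ
  p = suc q * 2

-- Window sums as multiples of their middle pair.

sum-applyUpTo-last : ∀ (h : ℕ → ℕ) m →
  sum (applyUpTo h (suc m)) ≡ sum (applyUpTo h m) + h m
sum-applyUpTo-last h m = begin
  sum (applyUpTo h (suc m))
    ≡⟨ cong sum (applyUpTo-∷ʳ h m) ⟨
  sum (applyUpTo h m ++ [ h m ])
    ≡⟨ sum-++ (applyUpTo h m) [ h m ] ⟩
  sum (applyUpTo h m) + (h m + 0)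
    ≡⟨ cong (_+_ (sum (applyUpTo h m))) (+-identityʳ (h m)) ⟩
  sum (applyUpTo h m) + h m ∎
  where open ≡-Reasoning

-- In closed form, `r` times this is `lucas r (N * 2)`. The recursive form avoids a division and
-- follows the growth of the window by outer pairs.
windowFactor : ℕ → ℕ → ℕ
windowFactor r zero    = 1
windowFactor r (suc N) = windowFactor r N + lucas r (suc (N * 2))

windowFactor>0 : ∀ r N → 0 < windowFactor r N
windowFactor>0 r zero    = z<s
windowFactor>0 r (suc N) = <-≤-trans (windowFactor>0 r N) (m≤m+n _ _)

-- The window of length 4 N + 6 is the one of length 4 N + 2 with two terms added at
-- each end; the added terms pair up symmetrically about the two middle ones.
window-sum : ∀ {r g} → Recurrent r g → ∀ N →
  sum (applyUpTo g (2 + (N * 2 + N * 2))) ≡ windowFactor r N * pairSum g (N * 2)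
window-sum {g = g} rec zero = regroup (g 0) (g 1)
  where
  regroup : ∀ x y → x + (y + 0) ≡ 1 * (x + y)
  regroup = solve-∀
window-sum {r} {g} rec (suc N) = begin
  g 0 + (g 1 + sum (applyUpTo g₂ (2 + (M + (2 + M)))))
    ≡⟨ cong (λ m → g 0 + (g 1 + sum (applyUpTo g₂ (2 + m)))) M+p≡ ⟩
  g 0 + (g 1 + sum (applyUpTo g₂ (2 + (2 + (M + M)))))
    ≡⟨ cong (λ s → g 0 + (g 1 + s)) (sum-applyUpTo-last g₂ (3 + (M + M))) ⟩
  g 0 + (g 1 + (sum (applyUpTo g₂ (3 + (M + M))) + g (5 + (M + M))))
    ≡⟨ cong (λ s → g 0 + (g 1 + (s + g (5 + (M + M))))) (sum-applyUpTo-last g₂ (2 + (M + M))) ⟩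
  g 0 + (g 1 + (sum (applyUpTo g₂ (2 + (M + M))) + g (4 + (M + M)) + g (5 + (M + M))))
    ≡⟨ cong (λ s → g 0 + (g 1 + (s + g (4 + (M + M)) + g (5 + (M + M)))))
         (window-sum (shift-recurrent 2 rec) N) ⟩
  g 0 + (g 1 + (E * (g p + g (suc p)) + g (4 + (M + M)) + g (5 + (M + M))))
    ≡⟨ regroup (g 0) (g 1) (E * (g p + g (suc p))) (g (4 + (M + M))) (g (5 + (M + M))) ⟩
  E * (g p + g (suc p)) + ((g 0 + g (4 + (M + M))) + (g 1 + g (5 + (M + M))))
    ≡⟨ cong (λ m → E * (g p + g (suc p)) + ((g 0 + g (2 + m)) + (g 1 + g (3 + m)))) M+p≡ ⟨
  E * (g p + g (suc p)) + ((g 0 + g (p + p)) + (g 1 + g (suc (p + p))))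
    ≡⟨ cong (_+_ (E * (g p + g (suc p))))
         (cong₂ _+_ (symmetric-sum rec N) (symmetric-sum (shift-recurrent 1 rec) N)) ⟩
  E * (g p + g (suc p)) + (L * g p + L * g (suc p))
    ≡⟨ collect E L (g p) (g (suc p)) ⟩
  (E + L) * (g p + g (suc p)) ∎
  where
  open ≡-Reasoning
  M p E L : ℕ
  M = N * 2
  p = 2 + M
  E = windowFactor r N
  L = lucas r (suc M)
  g₂ : ℕ → ℕ
  g₂ = g ∘ (_+_ 2)
  M+p≡ : M + p ≡ 2 + (M + M)
  M+p≡ = trans (+-suc M (suc M)) (cong suc (+-suc M M))
  regroup : ∀ a b s c d → a + (b + (s + c + d)) ≡ s + ((a + c) + (b + d))
  regroup = solve-∀
  collect : ∀ E L x y → E * (x + y) + (L * x + L * y) ≡ (E + L) * (x + y)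
  collect = solve-∀

window-sum-f : ∀ r N n →
  sum (map (λ i → f r (n + i)) (upTo (suc (4 * N + 1))))
  ≡ windowFactor r N * pairSum (f r) (n + N * 2)
window-sum-f r N n = begin
  sum (map h (upTo (suc (4 * N + 1))))
    ≡⟨ cong sum (map-upTo h (suc (4 * N + 1))) ⟩
  sum (applyUpTo h (suc (4 * N + 1)))
    ≡⟨ cong (sum ∘ applyUpTo h) (length≡ N) ⟩
  sum (applyUpTo h (2 + (N * 2 + N * 2)))
    ≡⟨ window-sum (shift-recurrent n (f-recurrent r)) N ⟩
  windowFactor r N * (f r (n + N * 2) + f r (n + suc (N * 2)))
    ≡⟨ cong (λ m → windowFactor r N * (f r (n + N * 2) + f r m)) (+-suc n (N * 2)) ⟩
  windowFactor r N * pairSum (f r) (n + N * 2) ∎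
  where
  open ≡-Reasoning
  h : ℕ → ℕ
  h i = f r (n + i)
  length≡ : ∀ N → suc (4 * N + 1) ≡ 2 + (N * 2 + N * 2)
  length≡ = solve-∀

-- Coprimality of neighbouring values.

coprime-cross : ∀ {a b c d} → Coprime a b → Coprime c d → a * d ≡ b * c → a ≡ c
-- Equal fractions in lowest terms have equal numerators: `a` divides `b * c` and is coprime to `b`,
-- while `c` divides `d * a` and is coprime to `d`.
coprime-cross {a} {b} {c} {d} a⊥b c⊥d ad≡bc = ∣-antisym
  (coprime-divisor a⊥b (divides d (trans (sym ad≡bc) (*-comm a d))))
  (coprime-divisor c⊥d (divides b (trans (*-comm d a) ad≡bc)))

f-coprime : ∀ r n → Coprime (f r n) (f r (suc n))
f-coprime r = consecutive-coprime (f-recurrent r) λ (_ , d∣1) → ∣1⇒≡1 d∣1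

pairSum-coprime : ∀ r n → Coprime (pairSum (f r) n) (pairSum (f r) (suc n))
pairSum-coprime r =
  consecutive-coprime (pairSum-recurrent (f-recurrent r)) λ (d∣1 , _) → ∣1⇒≡1 d∣1

-- Growth of the sequence and of its pair sums.

module _ {r} (2≤r : 2 ≤ r) where

  private
    T : ℕ → ℕ
    T = pairSum (f r)

  f>0 : ∀ n → 0 < f r (suc n)
  f>0 zero    = z<s
  f>0 (suc n) = <-≤-trans (f>0 n)
    (≤-trans (m≤n*m _ r ⦃ >-nonZero (<-trans z<s 2≤r) ⦄) (m≤m+n _ _))

  -- Strictness rests on `2 ≤ r`; for `r = 1` the two sides would be equal.
  T<f : ∀ n → T n < f r (2 + n)
  T<f n = begin-strict
    f r n + y          ≡⟨ +-comm (f r n) y ⟩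
    y + f r n          <⟨ +-monoˡ-< (f r n) (m<m*n y r ⦃ >-nonZero (f>0 n) ⦄ 2≤r) ⟩
    y * r + f r n      ≡⟨ cong (_+ f r n) (*-comm y r) ⟩
    r * y + f r n      ∎
    where
    open ≤-Reasoning
    y : ℕ
    y = f r (suc n)

  f-step : ∀ n → f r n ≤ f r (suc n)
  f-step zero    = z≤n
  f-step (suc n) = ≤-trans (m≤n+m _ (f r n)) (<⇒≤ (T<f n))

  f-mono : ∀ {m n} → m ≤ n → f r m ≤ f r n
  f-mono {n = zero}  z≤n = ≤-refl
  f-mono {m} {suc n} m≤1+n with m≤n⇒m<n∨m≡n m≤1+n
  ... | inj₁ m<1+n = ≤-trans (f-mono (s≤s⁻¹ m<1+n)) (f-step n)
  ... | inj₂ refl  = ≤-refl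

  f-cancel-< : ∀ m n → f r m < f r n → m < n
  f-cancel-< m n fm<fn = ≰⇒> λ n≤m → <⇒≱ fm<fn (f-mono n≤m)

  T-step : ∀ n → T n < T (suc n)
  T-step n = <-≤-trans (T<f n) (m≤n+m (f r (2 + n)) (f r (suc n)))

  -- The index `j` would lie strictly between `2 + n` and `3 + n`. The successor matters: `T 0`
  -- equals `f r 1`.
  T≢f : ∀ n j → ¬ T (suc n) ≡ f r j
  T≢f n j T≡f = <⇒≱ (f-cancel-< (2 + n) j f<) (s≤s⁻¹ (f-cancel-< j (3 + n) <f))
    where
    f< : f r (2 + n) < f r j
    f< = subst (f r (2 + n) <_) T≡f (m<n+m _ (f>0 n))
    <f : f r j < f r (3 + n)
    <f = subst (_< f r (3 + n)) T≡f (T<f (suc n))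

  -- Two consecutive windows sharing the factor `C`.

  module _ {E C j j′} n (0<E : 0 < E)
           (eq : E * T (suc n) ≡ C * f r j) (eq′ : E * T (2 + n) ≡ C * f r j′) where

    private instance
      E≢0 : NonZero E
      E≢0 = >-nonZero 0<E

    -- One step multiplies `T` by more than 1 but less than `r + 1`, whereas two steps multiply
    -- `f r` by at least `r + 1`. So the index `j` grows by at least one and by less than two.
    indices-adjacent : j′ ≡ suc j
    indices-adjacent = ≤-antisym (s≤s⁻¹ (f-cancel-< j′ (2 + j) upper)) (f-cancel-< j j′ lower)
      where
      open ≤-Reasoning
      lower : f r j < f r j′
      lower = *-cancelˡ-< C _ _ (begin-strict
        C * f r j      ≡⟨ eq ⟨
        E * T (suc n)  <⟨ *-monoʳ-< E (T-step (suc n)) ⟩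
        E * T (2 + n)  ≡⟨ eq′ ⟩
        C * f r j′     ∎)
      distrib : ∀ a r x → a * (r * x + x) ≡ suc r * (a * x)
      distrib = solve-∀
      upper : f r j′ < f r (2 + j)
      upper = *-cancelˡ-< C _ _ (begin-strict
        C * f r j′                        ≡⟨ eq′ ⟨
        E * T (2 + n)                     ≡⟨ cong (E *_) (step (pairSum-recurrent (f-recurrent r)) n) ⟩
        E * (r * T (suc n) + T n)         <⟨ *-monoʳ-< E (+-monoʳ-< (r * T (suc n)) (T-step n)) ⟩
        E * (r * T (suc n) + T (suc n))   ≡⟨ distrib E r (T (suc n)) ⟩
        suc r * (E * T (suc n))           ≡⟨ cong (suc r *_) eq ⟩
        suc r * (C * f r j)               ≡⟨ distrib C r (f r j) ⟨
        C * (r * f r j + f r j)           ≤⟨ *-monoʳ-≤ C (+-monoˡ-≤ (f r j) (*-monoʳ-≤ r (f-step j))) ⟩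
        C * f r (2 + j)                   ∎)

    -- Multiplying the two equations crosswise puts `C * E` on both sides, where it cancels.
    cross : T (suc n) * f r (suc j) ≡ T (2 + n) * f r j
    cross = *-cancelˡ-≡ _ _ E (*-cancelˡ-≡ _ _ C ⦃ C≢0 ⦄ (begin
      C * (E * (T (suc n) * f r (suc j)))      ≡⟨ regroup C E (T (suc n)) (f r (suc j)) ⟩
      (E * T (suc n)) * (C * f r (suc j))      ≡⟨ cong₂ _*_ eq eq″ ⟩
      (C * f r j) * (E * T (2 + n))            ≡⟨ regroup′ C E (T (2 + n)) (f r j) ⟩
      C * (E * (T (2 + n) * f r j))            ∎))
      where
      open ≡-Reasoning
      eq″ : C * f r (suc j) ≡ E * T (2 + n)
      eq″ = trans (cong (λ k → C * f r k) (sym indices-adjacent)) (sym eq′)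
      T≢0 : NonZero (T (suc n))
      T≢0 = >-nonZero (≤-<-trans z≤n (T-step n))
      C≢0 : NonZero C
      -- `C` divides the positive number `E * T (suc n)`.
      C≢0 = m*n≢0⇒m≢0 C ⦃ subst NonZero eq (m*n≢0 E (T (suc n)) ⦃ E≢0 ⦄ ⦃ T≢0 ⦄) ⦄
      regroup : ∀ C E t y → C * (E * (t * y)) ≡ (E * t) * (C * y)
      regroup = solve-∀
      regroup′ : ∀ C E t y → (C * y) * (E * t) ≡ C * (E * (t * y))
      regroup′ = solve-∀

    no-common-multiple : ⊥
    no-common-multiple =
      T≢f n j (coprime-cross (pairSum-coprime r (suc n)) (f-coprime r j) cross)

theorem4p2 : ∀ (r : ℕ) → 2 ≤ r → ∀ (N : ℕ) → 0 < N →
    ¬ (Σ[ C ∈ ℤ ] ∀ (n : ℕ) → ∃[ j ]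
    + sum (map (λ i → f r (n + i)) (upTo (suc (4 * N + 1)))) ≡ C ℤ.* (+ f r j))
theorem4p2 r 2≤r (suc N) 0<N (C , multiple) =
  -- The windows starting at 0 and 1 already conflict. Since `N` is positive, the first middle index
  -- `suc N * 2` is the successor of `suc (N * 2)`, as `T≢f` demands.
  let j , eq = multiple 0 ; j′ , eq′ = multiple 1 in
  no-common-multiple 2≤r {C = ℤ.∣ C ∣} {j} {j′} (suc (N * 2)) (windowFactor>0 r (suc N))
    (absolute 0 j eq) (absolute 1 j′ eq′)
  where
  -- Window sums and values of `f r` are nonnegative, so absolute values affect only `C`; this also
  -- covers negative `C`.
  absolute : ∀ n j →
    + sum (map (λ i → f r (n + i)) (upTo (suc (4 * suc N + 1)))) ≡ C ℤ.* (+ f r j) →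
    windowFactor r (suc N) * pairSum (f r) (n + suc N * 2) ≡ ℤ.∣ C ∣ * f r j
  absolute n j eq = trans (sym (window-sum-f r (suc N) n))
    (trans (cong ℤ.∣_∣ eq) (abs-* C (+ f r j)))
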